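{- Let $\mathbf{k}$ be a field of characteristic zero, and let $P$ be an arbitrary pseudo-involution in the Riordan group $\mathcal{R}$ over $\mathbf{k}$. Let $g(x)\in\mathbf{F}_0$ and $f(x)\in\mathbf{F}_1$ be arbitrary. Then the Riordan array $$(g(x), f(x))^{ -1}\cdot P\cdot (g(-x), f(-x))$$ is an involution in $\mathcal{R}$.
   Context: Let $\mathbf{k}$ be a field of characteristic zero. $\mathbf{F}_0$ is the set of formal power series $g(x)=g_0+g_1x+g_2x^2+\cdots$ over $\mathbf{k}$ with $g_0\neq 0$; $\mathbf{F}_1$ is the set of formal power series $f(x)=f_1x+f_2x^2+\cdots$ over $\mathbf{k}$ with zero constant term and $f_1\neq 0$. The Riordan group is $\mathcal{R}=\{(g(x),f(x)) : g\in\mathbf{F}_0,\ f\in\mathbf{F}_1\}$ with product $$(g(x),f(x))\cdot(u(x),v(x))=(g(x)\,u(f(x)),\ v(f(x))),$$ identity $(1,x)$, and inverse $(g(x),f(x))^{ -1}=\left(\frac{1}{g(\bar f(x))},\bar f(x)\right)$, where $\bar f$ is the compositional inverse of $f$. Elements of $\mathcal{R}$ are called Riordan arrays (the pair $(g,f)$ is identified with the lower-triangular matrix with $(n,k)$ entry $[x^n]g(x)f(x)^k$, the product corresponding to matrix multiplication). An involution in $\mathcal{R}$ is an element $A\in\mathcal{R}$ with $A\cdot A=(1,x)$. A pseudo-involution in $\mathcal{R}$ is an element $(g(x),f(x))\in\mathcal{R}$ such that $(g(x),f(x))\cdot(1,-x)=(g(x),-f(x))$ is an involution. -}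

module Defs where

open import Level using (Level; _⊔_)
open import Algebra.Apartness.Bundles using (HeytingField; HeytingCommutativeRing)
open import Algebra.Bundles using (CommutativeRing)
open import Data.Bool.Base using (if_then_else_)
open import Data.Fin.Base using (toℕ)
open import Data.Nat.Base using (ℕ; zero; suc; _∸_; _≡ᵇ_)
open import Data.Product.Base using (_×_; _,_; proj₁; proj₂)
import Algebra.Apartness.Properties.HeytingCommutativeRing as HeytingProperties
import Algebra.Properties.Ring as RingProperties
import Algebra.Properties.Semiring.Exp as SemiringExp
import Algebra.Properties.Semiring.Mult as SemiringMult
import Algebra.Properties.Semiring.Sum as SemiringSum
import Relation.Binary.Reasoning.Setoid as SetoidReasoning

-- A field is a `HeytingField`: "x ≠ y" is the tight apartness x # y, which the
-- axioms make equivalent to invertibility of x - y.  Classically x # y is just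
-- the negation of x ≈ y.

module Riordan {c ℓ₁ ℓ₂ : Level} (K : HeytingField c ℓ₁ ℓ₂) where

  open HeytingField K
    using (_#_; #⇒invertible; heytingCommutativeRing)
  open HeytingCommutativeRing heytingCommutativeRing using (commutativeRing)
  open CommutativeRing commutativeRing hiding (zero)
  open HeytingProperties heytingCommutativeRing
    using (1#0; x-0≈x; x#0y#0→xy#0; #-congʳ; invertibleˡ⇒#)
  open RingProperties ring using (-0#≈0#; -‿distribˡ-*; -‿involutive)
  open SemiringExp semiring using (_^_)
  open SemiringMult semiring using () renaming (_×_ to _·ℕ_)
  open SemiringSum semiring using (sum⁺-syntax)
  open SetoidReasoning setoid

  CharacteristicZero : Set ℓ₁
  CharacteristicZero = ∀ n → suc n ·ℕ 1# ≉ 0#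

  inverse : ∀ {x} → x # 0# → Carrier
  inverse x#0 = proj₁ (#⇒invertible x#0)

  inverse#0 : ∀ {x} (x#0 : x # 0#) → inverse x#0 # 0#
  inverse#0 {x} x#0 = invertibleˡ⇒# (x - 0# , (begin
    (x - 0#) * (inverse x#0 - 0#) ≈⟨ *-congˡ (x-0≈x _) ⟩
    (x - 0#) * inverse x#0        ≈⟨ proj₂ (proj₂ (#⇒invertible x#0)) ⟩
    1#                            ∎))

  -1#0 : - 1# # 0#
  -1#0 = invertibleˡ⇒# (- 1# , (begin
    - 1# * (- 1# - 0#) ≈⟨ *-congˡ (x-0≈x _) ⟩
    - 1# * - 1#        ≈⟨ -‿distribˡ-* 1# (- 1#) ⟨
    - (1# * - 1#)      ≈⟨ -‿cong (*-identityˡ (- 1#)) ⟩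
    - - 1#             ≈⟨ -‿involutive 1# ⟩
    1#                 ∎))

  -- The series Σ aₙxⁿ is its coefficient sequence n ↦ aₙ.
  Series : Set c
  Series = ℕ → Carrier

  infix 4 _≈ˢ_
  _≈ˢ_ : Series → Series → Set ℓ₁
  a ≈ˢ b = ∀ n → a n ≈ b n

  0ˢ 1ˢ xˢ : Series
  0ˢ _ = 0#

  1ˢ zero    = 1#
  1ˢ (suc _) = 0#

  xˢ zero    = 0#
  xˢ (suc n) = 1ˢ n

  infixl 7 _*ˢ_
  _*ˢ_ : Series → Series → Series
  (a *ˢ b) n = ∑[ i ≤ n ] (a (toℕ i) * b (n ∸ toℕ i))

  infixr 8 _^ˢ_
  _^ˢ_ : Series → ℕ → Series
  a ^ˢ zero  = 1ˢ
  a ^ˢ suc k = a *ˢ (a ^ˢ k)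

  -- u(f(x)).  Stopping the sum Σₖ uₖ [xⁿ]fᵏ at k = n is correct only when f has
  -- zero constant term.
  infixl 9 _∘ˢ_
  _∘ˢ_ : Series → Series → Series
  (u ∘ˢ f) n = ∑[ k ≤ n ] (u (toℕ k) * (f ^ˢ toℕ k) n)

  -- The series h determined by hₙ = step n (Σ_{k<n} hₖ xᵏ).
  module _ (step : ℕ → Series → Carrier) where

    truncation : ℕ → Series
    truncation zero    = 0ˢ
    truncation (suc n) m =
      if m ≡ᵇ n then step n (truncation n) else truncation n m

    recursiveSeries : Series
    recursiveSeries n = step n (truncation n)

  record F₀ : Set (c ⊔ ℓ₂) where
    constructor mkF₀
    field
      series   : Series
      const#0  : series 0 # 0#

  record F₁ : Set (c ⊔ ℓ₁ ⊔ ℓ₂) where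
    constructor mkF₁
    field
      series    : Series
      const≈0   : series 0 ≈ 0#
      linear#0  : series 1 # 0#

  ∘ˢ-const : ∀ u f → (u ∘ˢ f) 0 ≈ u 0
  ∘ˢ-const u f = trans (+-identityʳ _) (*-identityʳ _)

  ^1-linear : ∀ f → (f ^ˢ 1) 1 ≈ f 1
  ^1-linear f = begin
    f 0 * 0# + (f 1 * 1# + 0#) ≈⟨ +-congʳ (zeroʳ (f 0)) ⟩
    0# + (f 1 * 1# + 0#)       ≈⟨ +-identityˡ _ ⟩
    f 1 * 1# + 0#              ≈⟨ +-identityʳ _ ⟩
    f 1 * 1#                   ≈⟨ *-identityʳ _ ⟩
    f 1                        ∎

  ∘ˢ-linear : ∀ u f → (u ∘ˢ f) 1 ≈ u 1 * f 1
  ∘ˢ-linear u f = begin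
    u 0 * 0# + (u 1 * (f ^ˢ 1) 1 + 0#) ≈⟨ +-congʳ (zeroʳ (u 0)) ⟩
    0# + (u 1 * (f ^ˢ 1) 1 + 0#)       ≈⟨ +-identityˡ _ ⟩
    u 1 * (f ^ˢ 1) 1 + 0#              ≈⟨ +-identityʳ _ ⟩
    u 1 * (f ^ˢ 1) 1                   ≈⟨ *-congˡ (^1-linear f) ⟩
    u 1 * f 1                          ∎

  1₀ : F₀
  1₀ = mkF₀ 1ˢ 1#0

  X -X : F₁
  X  = mkF₁ xˢ refl 1#0
  -X = mkF₁ (λ n → - xˢ n) -0#≈0# -1#0

  infixl 7 _*₀_
  _*₀_ : F₀ → F₀ → F₀
  mkF₀ g g₀#0 *₀ mkF₀ h h₀#0 =
    mkF₀ (g *ˢ h) (#-congʳ (sym (+-identityʳ _)) (x#0y#0→xy#0 g₀#0 h₀#0))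

  infixl 9 _∘₀_ _∘₁_

  _∘₀_ : F₀ → F₁ → F₀
  mkF₀ u u₀#0 ∘₀ mkF₁ f _ _ = mkF₀ (u ∘ˢ f) (#-congʳ (sym (∘ˢ-const u f)) u₀#0)

  _∘₁_ : F₁ → F₁ → F₁
  mkF₁ v v₀≈0 v₁#0 ∘₁ mkF₁ f f₀≈0 f₁#0 = mkF₁ (v ∘ˢ f)
    (trans (∘ˢ-const v f) v₀≈0)
    (#-congʳ (sym (∘ˢ-linear v f)) (x#0y#0→xy#0 v₁#0 f₁#0))

  -- 1/g.  If h = Σ_{k<n} hₖxᵏ then adding hₙxⁿ changes [xⁿ](g h) by g₀hₙ, so
  -- [xⁿ](g/g) = [xⁿ]1 forces hₙ = g₀⁻¹ [xⁿ](1 - g h).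
  reciprocal : F₀ → F₀
  reciprocal (mkF₀ g g₀#0) =
    mkF₀ (recursiveSeries step)
         (#-congʳ (sym const) (inverse#0 g₀#0))
    where
    step : ℕ → Series → Carrier
    step n h = inverse g₀#0 * (1ˢ n - (g *ˢ h) n)

    const : recursiveSeries step 0 ≈ inverse g₀#0
    const = begin
      inverse g₀#0 * (1# - (g 0 * 0# + 0#))
        ≈⟨ *-congˡ (+-congˡ (-‿cong (trans (+-identityʳ _) (zeroʳ (g 0))))) ⟩
      inverse g₀#0 * (1# - 0#) ≈⟨ *-congˡ (x-0≈x 1#) ⟩
      inverse g₀#0 * 1#        ≈⟨ *-identityʳ _ ⟩
      inverse g₀#0             ∎

  -- The compositional inverse f̄.  If h = Σ_{k<n} f̄ₖxᵏ then adding f̄ₙxⁿ changes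
  -- [xⁿ] h(f(x)) by f̄ₙ [xⁿ]fⁿ = f̄ₙ f₁ⁿ, so f̄(f(x)) = x forces
  -- f̄ₙ = f₁⁻ⁿ [xⁿ](x - h(f(x))).
  compInverse : F₁ → F₁
  compInverse (mkF₁ f f₀≈0 f₁#0) =
    mkF₁ f̄ const (#-congʳ (sym linear) (inverse#0 f₁#0))
    where
    step : ℕ → Series → Carrier
    step n h = inverse f₁#0 ^ n * (xˢ n - (h ∘ˢ f) n)

    f̄ : Series
    f̄ = recursiveSeries step

    const : f̄ 0 ≈ 0#
    const = begin
      1# * (0# - (0ˢ ∘ˢ f) 0) ≈⟨ *-identityˡ _ ⟩
      0# - (0ˢ ∘ˢ f) 0        ≈⟨ +-congˡ (-‿cong (∘ˢ-const 0ˢ f)) ⟩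
      0# - 0#                 ≈⟨ x-0≈x 0# ⟩
      0#                      ∎

    linear : f̄ 1 ≈ inverse f₁#0
    linear = begin
      inverse f₁#0 ^ 1 * (1# - (truncation step 1 ∘ˢ f) 1)
        ≈⟨ *-cong (*-identityʳ _) (+-congˡ (-‿cong (∘ˢ-linear (truncation step 1) f))) ⟩
      inverse f₁#0 * (1# - 0# * f 1) ≈⟨ *-congˡ (+-congˡ (-‿cong (zeroˡ (f 1)))) ⟩
      inverse f₁#0 * (1# - 0#)       ≈⟨ *-congˡ (x-0≈x 1#) ⟩
      inverse f₁#0 * 1#              ≈⟨ *-identityʳ _ ⟩
      inverse f₁#0                   ∎

  ℛ : Set (c ⊔ ℓ₁ ⊔ ℓ₂)
  ℛ = F₀ × F₁

  infix 4 _≈ᴿ_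
  _≈ᴿ_ : ℛ → ℛ → Set ℓ₁
  (g , f) ≈ᴿ (u , v) =
    (F₀.series g ≈ˢ F₀.series u) × (F₁.series f ≈ˢ F₁.series v)

  infixl 7 _∙_
  _∙_ : ℛ → ℛ → ℛ
  (g , f) ∙ (u , v) = g *₀ (u ∘₀ f) , v ∘₁ f

  ε : ℛ
  ε = 1₀ , X

  infix 8 _⁻¹
  _⁻¹ : ℛ → ℛ
  (g , f) ⁻¹ = reciprocal (g ∘₀ compInverse f) , compInverse f

  IsInvolution : ℛ → Set ℓ₁
  IsInvolution A = A ∙ A ≈ᴿ ε

  IsPseudoInvolution : ℛ → Set ℓ₁
  IsPseudoInvolution A = IsInvolution (A ∙ (1₀ , -X))

{-# OPTIONS --safe #-}

-- With D = (1, -x), the array (g(-x), f(-x)) is D ∙ (g , f), so the element in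
-- question is the conjugate of the involution P ∙ D by (g , f).  What remains is
-- that ℛ is a group.  Composition with f is governed by Horner's rule
--   u(f) = u₀ + f · u'(f)   where u = u₀ + x u',
-- which determines u ↦ u(f) coefficient by coefficient because f₀ = 0.  So
-- (u v)(f) = u(f) v(f) and (u(f))(h) = u(f(h)) hold because, as functions of u,
-- both sides obey the same recursion.

module Submission where

open import Defs
open import Level using (Level)
open import Algebra.Apartness.Bundles using (HeytingField; HeytingCommutativeRing)
open import Algebra.Bundles using (CommutativeRing; Monoid; Group)
open import Data.Bool.Base using (T; true; false)
open import Data.Fin.Base using (toℕ)
open import Data.Nat.Base using (ℕ; zero; suc; _∸_; _≡ᵇ_; _≤_; _<_; z≤n; s≤s; s≤s⁻¹)
import Data.Nat.Properties as ℕ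
open import Data.Product.Base using (_,_; proj₁; proj₂)
open import Data.Unit.Base using (tt)
open import Relation.Binary.Bundles using (Setoid)
open import Relation.Binary.PropositionalEquality as ≡ using (_≡_)
open import Relation.Nullary.Negation using (contradiction)
import Algebra.Apartness.Properties.HeytingCommutativeRing as HeytingProperties
import Algebra.Properties.CommutativeSemigroup as CommutativeSemigroupProperties
import Algebra.Properties.CommutativeSemiring.Exp as CommutativeSemiringExp
import Algebra.Properties.Group as GroupProperties
import Algebra.Properties.Semiring.Exp as SemiringExp
import Algebra.Properties.Semiring.Sum as SemiringSum
import Relation.Binary.Reasoning.Setoid as SetoidReasoning

-- Groups and conjugates of involutions

module _ {c ℓ} (M : Monoid c ℓ) where
  open Monoid M
  open SetoidReasoning setoid

  -- The right inverse `i x` has itself a right inverse `i (i x)`, and inserting `i x ∙ i (i x)`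
  -- after `x` turns `i x` into a left inverse. In the Riordan group the right inverse law is the
  -- one that the recursive construction yields directly.
  rightInverses⇒group : (i : Carrier → Carrier) → (∀ x → x ∙ i x ≈ ε) → Group c ℓ
  rightInverses⇒group i inverseʳ = record
    { isGroup = record
      { isMonoid = isMonoid
      ; inverse  = inverseˡ , inverseʳ
      ; ⁻¹-cong  = i-cong
      }
    }
    where
    inverseˡ : ∀ x → i x ∙ x ≈ ε
    inverseˡ x = begin
      i x ∙ x                     ≈⟨ ∙-congˡ (identityʳ x) ⟨
      i x ∙ (x ∙ ε)               ≈⟨ ∙-congˡ (∙-congˡ (inverseʳ (i x))) ⟨
      i x ∙ (x ∙ (i x ∙ i (i x))) ≈⟨ ∙-congˡ (assoc x (i x) (i (i x))) ⟨
      i x ∙ ((x ∙ i x) ∙ i (i x)) ≈⟨ ∙-congˡ (∙-congʳ (inverseʳ x)) ⟩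
      i x ∙ (ε ∙ i (i x))         ≈⟨ ∙-congˡ (identityˡ _) ⟩
      i x ∙ i (i x)               ≈⟨ inverseʳ (i x) ⟩
      ε                           ∎

    -- Uniqueness of inverses gives congruence, so nothing about how `i` is computed enters.
    i-cong : ∀ {x y} → x ≈ y → i x ≈ i y
    i-cong {x} {y} x≈y = begin
      i x               ≈⟨ identityʳ (i x) ⟨
      i x ∙ ε           ≈⟨ ∙-congˡ (inverseʳ y) ⟨
      i x ∙ (y ∙ i y)   ≈⟨ assoc (i x) y (i y) ⟨
      (i x ∙ y) ∙ i y   ≈⟨ ∙-congʳ (∙-congˡ x≈y) ⟨
      (i x ∙ x) ∙ i y   ≈⟨ ∙-congʳ (inverseˡ x) ⟩
      ε ∙ i y           ≈⟨ identityˡ (i y) ⟩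
      i y               ∎

module _ {c ℓ} (G : Group c ℓ) where
  open Group G
  open GroupProperties G using (\\-leftDividesˡ)
  open SetoidReasoning setoid

  conjugate-involution : ∀ b x → x ∙ x ≈ ε →
    (b ⁻¹ ∙ (x ∙ b)) ∙ (b ⁻¹ ∙ (x ∙ b)) ≈ ε
  conjugate-involution b x x²≈ε = begin
    (b ⁻¹ ∙ (x ∙ b)) ∙ (b ⁻¹ ∙ (x ∙ b)) ≈⟨ assoc _ _ _ ⟩
    b ⁻¹ ∙ ((x ∙ b) ∙ (b ⁻¹ ∙ (x ∙ b))) ≈⟨ ∙-congˡ (assoc _ _ _) ⟩
    b ⁻¹ ∙ (x ∙ (b ∙ (b ⁻¹ ∙ (x ∙ b)))) ≈⟨ ∙-congˡ (∙-congˡ (\\-leftDividesˡ b (x ∙ b))) ⟩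
    b ⁻¹ ∙ (x ∙ (x ∙ b))                ≈⟨ ∙-congˡ (assoc x x b) ⟨
    b ⁻¹ ∙ ((x ∙ x) ∙ b)                ≈⟨ ∙-congˡ (∙-congʳ x²≈ε) ⟩
    b ⁻¹ ∙ (ε ∙ b)                      ≈⟨ ∙-congˡ (identityˡ b) ⟩
    b ⁻¹ ∙ b                            ≈⟨ inverseˡ b ⟩
    ε                                   ∎

  -- Absorbing `d` into `p` makes the element the ordinary conjugate of `p ∙ d` by `b`.
  twisted-conjugate-involution : ∀ b b′ p d → b′ ≈ d ∙ b → (p ∙ d) ∙ (p ∙ d) ≈ ε →
    (b ⁻¹ ∙ p ∙ b′) ∙ (b ⁻¹ ∙ p ∙ b′) ≈ ε
  twisted-conjugate-involution b b′ p d b′≈db [pd]²≈ε = begin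
    (b ⁻¹ ∙ p ∙ b′) ∙ (b ⁻¹ ∙ p ∙ b′)               ≈⟨ ∙-cong conjugate conjugate ⟩
    (b ⁻¹ ∙ (p ∙ d ∙ b)) ∙ (b ⁻¹ ∙ (p ∙ d ∙ b))     ≈⟨ conjugate-involution b (p ∙ d) [pd]²≈ε ⟩
    ε                                               ∎
    where
    conjugate : b ⁻¹ ∙ p ∙ b′ ≈ b ⁻¹ ∙ (p ∙ d ∙ b)
    conjugate = begin
      b ⁻¹ ∙ p ∙ b′        ≈⟨ assoc (b ⁻¹) p b′ ⟩
      b ⁻¹ ∙ (p ∙ b′)      ≈⟨ ∙-congˡ (∙-congˡ b′≈db) ⟩
      b ⁻¹ ∙ (p ∙ (d ∙ b)) ≈⟨ ∙-congˡ (assoc p d b) ⟨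
      b ⁻¹ ∙ (p ∙ d ∙ b)   ∎

module RiordanGroup {c ℓ₁ ℓ₂ : Level} (K : HeytingField c ℓ₁ ℓ₂) where

  open Riordan K
  open HeytingField K using (_#_; #⇒invertible; heytingCommutativeRing)
  open HeytingCommutativeRing heytingCommutativeRing using (commutativeRing)
  open CommutativeRing commutativeRing hiding (zero)
  open HeytingProperties heytingCommutativeRing using (x-0≈x)
  open CommutativeSemigroupProperties +-commutativeSemigroup
    using () renaming (x∙yz≈y∙xz to x+[y+z]≈y+[x+z])
  open CommutativeSemigroupProperties *-commutativeSemigroup
    using () renaming (x∙yz≈y∙xz to x*[y*z]≈y*[x*z])
  open SemiringExp semiring using (_^_; ^-congˡ)
  open CommutativeSemiringExp commutativeSemiring using (^-distrib-*)
  open SemiringSum semiring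
    using ( sum; sum⁺-syntax; sum-cong-≋; sum-replicate-zero
          ; ∑-distrib-+; ∑-comm; *-distribˡ-sum)

  -- Equality, sums and scalar multiples of series

  seriesSetoid : Setoid c ℓ₁
  seriesSetoid = record
    { _≈_           = _≈ˢ_
    ; isEquivalence = record
      { refl  = λ _ → refl
      ; sym   = λ p n → sym (p n)
      ; trans = λ p q n → trans (p n) (q n)
      }
    }

  open Setoid seriesSetoid public using ()
    renaming (refl to reflˢ; sym to symˢ; trans to transˢ)

  module ≈-Reasoning  = SetoidReasoning setoid
  module ≈ˢ-Reasoning = SetoidReasoning seriesSetoid

  tail : Series → Series
  tail u n = u (suc n)

  infixl 6 _+ˢ_
  _+ˢ_ : Series → Series → Series
  (u +ˢ v) n = u n + v n

  infixr 8 _·ˢ_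
  _·ˢ_ : Carrier → Series → Series
  (a ·ˢ u) n = a * u n

  x≈0⇒x*y≈0 : ∀ {x} y → x ≈ 0# → x * y ≈ 0#
  x≈0⇒x*y≈0 y x≈0 = trans (*-congʳ x≈0) (zeroˡ y)

  +ˢ-cong : ∀ {u u′ v v′} → u ≈ˢ u′ → v ≈ˢ v′ → u +ˢ v ≈ˢ u′ +ˢ v′
  +ˢ-cong p q n = +-cong (p n) (q n)

  +ˢ-congˡ : ∀ u {v v′} → v ≈ˢ v′ → u +ˢ v ≈ˢ u +ˢ v′
  +ˢ-congˡ _ q n = +-congˡ (q n)

  ·ˢ-cong : ∀ {a b u v} → a ≈ b → u ≈ˢ v → a ·ˢ u ≈ˢ b ·ˢ v
  ·ˢ-cong p q n = *-cong p (q n)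

  -- Multiplication of series

  *ˢ-cong-≤ : ∀ u v w n → (∀ {m} → m ≤ n → v m ≈ w m) → (u *ˢ v) n ≈ (u *ˢ w) n
  *ˢ-cong-≤ u v w n v≈w = sum-cong-≋ {suc n} λ i → *-congˡ {u (toℕ i)} (v≈w (ℕ.m∸n≤m n (toℕ i)))

  *ˢ-cong : ∀ {u u′ v v′} → u ≈ˢ u′ → v ≈ˢ v′ → u *ˢ v ≈ˢ u′ *ˢ v′
  *ˢ-cong p q n = sum-cong-≋ {suc n} λ i → *-cong (p (toℕ i)) (q (n ∸ toℕ i))

  *ˢ-congˡ : ∀ u {v v′} → v ≈ˢ v′ → u *ˢ v ≈ˢ u *ˢ v′
  *ˢ-congˡ u = *ˢ-cong {u} reflˢ

  *ˢ-congʳ : ∀ {u u′} v → u ≈ˢ u′ → u *ˢ v ≈ˢ u′ *ˢ v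
  *ˢ-congʳ v p = *ˢ-cong {v = v} p reflˢ

  *ˢ-distribˡ-+ˢ : ∀ u v w → u *ˢ (v +ˢ w) ≈ˢ u *ˢ v +ˢ u *ˢ w
  *ˢ-distribˡ-+ˢ u v w n =
    trans (sum-cong-≋ {suc n} (λ i → distribˡ (u (toℕ i)) (v (n ∸ toℕ i)) (w (n ∸ toℕ i))))
          (∑-distrib-+ {suc n} (λ i → u (toℕ i) * v (n ∸ toℕ i)) (λ i → u (toℕ i) * w (n ∸ toℕ i)))

  *ˢ-distribʳ-+ˢ : ∀ u v w → (v +ˢ w) *ˢ u ≈ˢ v *ˢ u +ˢ w *ˢ u
  *ˢ-distribʳ-+ˢ u v w n =
    trans (sum-cong-≋ {suc n} (λ i → distribʳ (u (n ∸ toℕ i)) (v (toℕ i)) (w (toℕ i))))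
          (∑-distrib-+ {suc n} (λ i → v (toℕ i) * u (n ∸ toℕ i)) (λ i → w (toℕ i) * u (n ∸ toℕ i)))

  ·ˢ-*ˢ : ∀ a u v → (a ·ˢ u) *ˢ v ≈ˢ a ·ˢ (u *ˢ v)
  ·ˢ-*ˢ a u v n =
    trans (sum-cong-≋ {suc n} (λ i → *-assoc a (u (toℕ i)) (v (n ∸ toℕ i))))
          (sym (*-distribˡ-sum {suc n} a (λ i → u (toℕ i) * v (n ∸ toℕ i))))

  *ˢ-·ˢ : ∀ u a v → u *ˢ (a ·ˢ v) ≈ˢ a ·ˢ (u *ˢ v)
  *ˢ-·ˢ u a v n =
    trans (sum-cong-≋ {suc n} (λ i → x*[y*z]≈y*[x*z] (u (toℕ i)) a (v (n ∸ toℕ i))))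
          (sym (*-distribˡ-sum {suc n} a (λ i → u (toℕ i) * v (n ∸ toℕ i))))

  -- The definition of `_*ˢ_` unfolds by peeling `u 0` off the left factor; this is the mirror image
  -- for the right factor, as commutativity requires.
  *ˢ-suc : ∀ u v n → (u *ˢ v) (suc n) ≈ u (suc n) * v 0 + (u *ˢ tail v) n
  *ˢ-suc u v zero    = x+[y+z]≈y+[x+z] (u 0 * v 1) (u 1 * v 0) 0#
  *ˢ-suc u v (suc n) =
    trans (+-congˡ (*ˢ-suc (tail u) v n)) (x+[y+z]≈y+[x+z] _ _ _)

  *ˢ-comm : ∀ u v → u *ˢ v ≈ˢ v *ˢ u
  *ˢ-comm u v zero    = +-congʳ (*-comm (u 0) (v 0))
  *ˢ-comm u v (suc n) =
    trans (+-cong (*-comm (u 0) (v (suc n))) (*ˢ-comm (tail u) v n))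
          (sym (*ˢ-suc v u n))

  *ˢ-zeroˡ : ∀ u → 0ˢ *ˢ u ≈ˢ 0ˢ
  *ˢ-zeroˡ u n = trans (sum-cong-≋ {suc n} (λ i → zeroˡ (u (n ∸ toℕ i))))
                       (sum-replicate-zero (suc n))

  *ˢ-zeroʳ : ∀ u → u *ˢ 0ˢ ≈ˢ 0ˢ
  *ˢ-zeroʳ u = transˢ (*ˢ-comm u 0ˢ) (*ˢ-zeroˡ u)

  *ˢ-identityˡ : ∀ u → 1ˢ *ˢ u ≈ˢ u
  *ˢ-identityˡ u zero    = trans (+-identityʳ _) (*-identityˡ (u 0))
  *ˢ-identityˡ u (suc n) =
    trans (+-cong (*-identityˡ (u (suc n))) (*ˢ-zeroˡ u n)) (+-identityʳ _)

  *ˢ-identityʳ : ∀ u → u *ˢ 1ˢ ≈ˢ u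
  *ˢ-identityʳ u = transˢ (*ˢ-comm u 1ˢ) (*ˢ-identityˡ u)

  *ˢ-assoc : ∀ u v w → (u *ˢ v) *ˢ w ≈ˢ u *ˢ (v *ˢ w)
  *ˢ-assoc u v w zero = +-congʳ (begin
    (u 0 * v 0 + 0#) * w 0 ≈⟨ *-congʳ (+-identityʳ _) ⟩
    u 0 * v 0 * w 0        ≈⟨ *-assoc _ _ _ ⟩
    u 0 * (v 0 * w 0)      ≈⟨ *-congˡ (+-identityʳ _) ⟨
    u 0 * (v 0 * w 0 + 0#) ∎)
    where open ≈-Reasoning
  -- By definition `tail (u *ˢ v)` is `u 0 ·ˢ tail v +ˢ tail u *ˢ v`.
  *ˢ-assoc u v w (suc n) = begin
    (u 0 * v 0 + 0#) * w (suc n) + ((u 0 ·ˢ tail v +ˢ tail u *ˢ v) *ˢ w) n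
      ≈⟨ +-cong (*-congʳ (+-identityʳ _)) (*ˢ-distribʳ-+ˢ w (u 0 ·ˢ tail v) (tail u *ˢ v) n) ⟩
    u 0 * v 0 * w (suc n) + (((u 0 ·ˢ tail v) *ˢ w) n + ((tail u *ˢ v) *ˢ w) n)
      ≈⟨ +-cong (*-assoc _ _ _) (+-cong (·ˢ-*ˢ (u 0) (tail v) w n) (*ˢ-assoc (tail u) v w n)) ⟩
    u 0 * (v 0 * w (suc n)) + (u 0 * (tail v *ˢ w) n + (tail u *ˢ (v *ˢ w)) n)
      ≈⟨ +-assoc _ _ _ ⟨
    u 0 * (v 0 * w (suc n)) + u 0 * (tail v *ˢ w) n + (tail u *ˢ (v *ˢ w)) n
      ≈⟨ +-congʳ (distribˡ _ _ _) ⟨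
    u 0 * (v *ˢ w) (suc n) + (tail u *ˢ (v *ˢ w)) n ∎
    where open ≈-Reasoning

  -- Horner's rule

  -- The only term that sees `v n` carries the factor `f 0`. This strict drop in the index is what
  -- makes Horner's rule a recursion on coefficients.
  *ˢ-cong-< : ∀ f v w → f 0 ≈ 0# → ∀ n → (∀ {m} → m < n → v m ≈ w m) →
    (f *ˢ v) n ≈ (f *ˢ w) n
  *ˢ-cong-< f v w f₀≈0 zero    v≈w =
    +-congʳ (trans (x≈0⇒x*y≈0 _ f₀≈0) (sym (x≈0⇒x*y≈0 _ f₀≈0)))
  *ˢ-cong-< f v w f₀≈0 (suc n) v≈w =
    +-cong (trans (x≈0⇒x*y≈0 _ f₀≈0) (sym (x≈0⇒x*y≈0 _ f₀≈0)))
           (*ˢ-cong-≤ (tail f) v w n (λ m≤n → v≈w (s≤s m≤n)))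

  -- The rule obeyed by `u ↦ u(f) w`. Composition is the case `w = 1ˢ`; multiplicativity takes
  -- `w = v ∘ˢ f`.
  Horner : Series → Series → (Series → Series) → Set _
  Horner f w Φ = ∀ u → Φ u ≈ˢ u 0 ·ˢ w +ˢ f *ˢ Φ (tail u)

  Horner-unique : ∀ f {w} Φ Ψ → f 0 ≈ 0# → Horner f w Φ → Horner f w Ψ →
    ∀ u → Φ u ≈ˢ Ψ u
  Horner-unique f {w} Φ Ψ f₀≈0 Φ-horner Ψ-horner u n =
    agree (suc n) u (ℕ.n<1+n n)
    where
    open ≈-Reasoning
    -- Strong induction on `m`, run through the bound `n`; `u` is general because the rule passes to
    -- `tail u`.
    agree : ∀ n u {m} → m < n → Φ u m ≈ Ψ u m
    agree (suc n) u {m} (s≤s m≤n) = begin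
      Φ u m                              ≈⟨ Φ-horner u m ⟩
      u 0 * w m + (f *ˢ Φ (tail u)) m    ≈⟨ +-congˡ (*ˢ-cong-< f (Φ (tail u)) (Ψ (tail u)) f₀≈0 m λ j<m →
                                              agree n (tail u) (ℕ.<-≤-trans j<m m≤n)) ⟩
      u 0 * w m + (f *ˢ Ψ (tail u)) m    ≈⟨ Ψ-horner u m ⟨
      Ψ u m                              ∎

  -- In `u ∘ˢ f` the cut-off grows with the coefficient, so different coefficients are sums of
  -- different lengths. Here the cut-off `N` is independent of `n`, and `(u ∘ˢ f) n` is
  -- `partial n u f n`.
  partial : ℕ → Series → Series → Series
  partial N u f n = ∑[ k ≤ N ] (u (toℕ k) * (f ^ˢ toℕ k) n)

  -- Split off `k = 0`, take one factor `f` out of every other power, and exchange the sum over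
  -- powers with the Cauchy sum.
  partial-Horner : ∀ N u f →
    partial (suc N) u f ≈ˢ u 0 ·ˢ 1ˢ +ˢ f *ˢ partial N (tail u) f
  partial-Horner N u f n = +-congˡ (begin
    sum {suc N} (λ k → u (suc (toℕ k)) * sum {suc n} (λ i → f (toℕ i) * p k i))
      ≈⟨ sum-cong-≋ {suc N} (λ k → *-distribˡ-sum {suc n} (u (suc (toℕ k))) (λ i → f (toℕ i) * p k i)) ⟩
    sum {suc N} (λ k → sum {suc n} (λ i → u (suc (toℕ k)) * (f (toℕ i) * p k i)))
      ≈⟨ ∑-comm {suc N} {suc n} (λ k i → u (suc (toℕ k)) * (f (toℕ i) * p k i)) ⟩
    sum {suc n} (λ i → sum {suc N} (λ k → u (suc (toℕ k)) * (f (toℕ i) * p k i)))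
      ≈⟨ sum-cong-≋ {suc n} (λ i → trans
           (sum-cong-≋ {suc N} (λ k → x*[y*z]≈y*[x*z] (u (suc (toℕ k))) (f (toℕ i)) (p k i)))
           (sym (*-distribˡ-sum {suc N} (f (toℕ i)) (λ k → u (suc (toℕ k)) * p k i)))) ⟩
    (f *ˢ partial N (tail u) f) n ∎)
    where
    open ≈-Reasoning
    p = λ k i → (f ^ˢ toℕ {suc N} k) (n ∸ toℕ {suc n} i)

  -- Powers above the `n`-th do not reach xⁿ. The induction on `n` obtains this from
  -- `partial-Horner`, whose factor `f` leaves only lower coefficients to compare.
  partial-stable : ∀ f → f 0 ≈ 0# → ∀ {N M n} u → n ≤ N → n ≤ M →
    partial N u f n ≈ partial M u f n
  partial-stable f f₀≈0 {N} {M} {zero} u _ _ = trans (const N) (sym (const M))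
    where
    open ≈-Reasoning
    const : ∀ N → partial N u f 0 ≈ u 0 * 1#
    const zero    = +-identityʳ _
    const (suc N) = begin
      partial (suc N) u f 0                        ≈⟨ partial-Horner N u f 0 ⟩
      u 0 * 1# + (f 0 * partial N (tail u) f 0 + 0#) ≈⟨ +-congˡ (+-identityʳ _) ⟩
      u 0 * 1# + f 0 * partial N (tail u) f 0      ≈⟨ +-congˡ (x≈0⇒x*y≈0 _ f₀≈0) ⟩
      u 0 * 1# + 0#                                ≈⟨ +-identityʳ _ ⟩
      u 0 * 1#                                     ∎
  partial-stable f f₀≈0 {suc N} {suc M} {suc n} u (s≤s n≤N) (s≤s n≤M) = begin
    partial (suc N) u f (suc n)                     ≈⟨ partial-Horner N u f (suc n) ⟩
    u 0 * 0# + (f *ˢ partial N (tail u) f) (suc n)  ≈⟨ +-congˡ (*ˢ-cong-< f _ _ f₀≈0 (suc n) step) ⟩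
    u 0 * 0# + (f *ˢ partial M (tail u) f) (suc n)  ≈⟨ partial-Horner M u f (suc n) ⟨
    partial (suc M) u f (suc n)                     ∎
    where
    open ≈-Reasoning
    step : ∀ {m} → m < suc n → partial N (tail u) f m ≈ partial M (tail u) f m
    step (s≤s m≤n) = partial-stable f f₀≈0 (tail u) (ℕ.≤-trans m≤n n≤N) (ℕ.≤-trans m≤n n≤M)

  ∘ˢ-Horner : ∀ f → f 0 ≈ 0# → Horner f 1ˢ (_∘ˢ f)
  ∘ˢ-Horner f f₀≈0 u n = begin
    partial n u f n
      -- The cut-off is raised by one so that `partial-Horner` applies; afterwards each inner
      -- coefficient `m` has its cut-off lowered from `n` to `m`.
      ≈⟨ partial-stable f f₀≈0 u ℕ.≤-refl (ℕ.n≤1+n n) ⟩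
    partial (suc n) u f n
      ≈⟨ partial-Horner n u f n ⟩
    u 0 * 1ˢ n + (f *ˢ partial n (tail u) f) n
      ≈⟨ +-congˡ (*ˢ-cong-≤ f (partial n (tail u) f) (tail u ∘ˢ f) n λ m≤n →
           partial-stable f f₀≈0 (tail u) m≤n ℕ.≤-refl) ⟩
    u 0 * 1ˢ n + (f *ˢ (tail u ∘ˢ f)) n ∎
    where open ≈-Reasoning

  -- Composition of series

  ^ˢ-cong : ∀ {f f′} → f ≈ˢ f′ → ∀ k → f ^ˢ k ≈ˢ f′ ^ˢ k
  ^ˢ-cong p zero    = reflˢ
  ^ˢ-cong p (suc k) = *ˢ-cong p (^ˢ-cong p k)

  ∘ˢ-cong : ∀ {u u′ f f′} → u ≈ˢ u′ → f ≈ˢ f′ → u ∘ˢ f ≈ˢ u′ ∘ˢ f′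
  ∘ˢ-cong p q n = sum-cong-≋ {suc n} λ k → *-cong (p (toℕ k)) (^ˢ-cong q (toℕ k) n)

  ∘ˢ-congˡ : ∀ u {f f′} → f ≈ˢ f′ → u ∘ˢ f ≈ˢ u ∘ˢ f′
  ∘ˢ-congˡ u = ∘ˢ-cong {u} reflˢ

  ∘ˢ-congʳ : ∀ {u u′} f → u ≈ˢ u′ → u ∘ˢ f ≈ˢ u′ ∘ˢ f
  ∘ˢ-congʳ f p = ∘ˢ-cong {f = f} p reflˢ

  ∘ˢ-distribʳ-+ˢ : ∀ f u v → (u +ˢ v) ∘ˢ f ≈ˢ u ∘ˢ f +ˢ v ∘ˢ f
  ∘ˢ-distribʳ-+ˢ f u v n =
    trans (sum-cong-≋ {suc n} (λ k → distribʳ ((f ^ˢ toℕ k) n) (u (toℕ k)) (v (toℕ k))))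
          (∑-distrib-+ {suc n} (λ k → u (toℕ k) * (f ^ˢ toℕ k) n) (λ k → v (toℕ k) * (f ^ˢ toℕ k) n))

  ·ˢ-∘ˢ : ∀ a u f → (a ·ˢ u) ∘ˢ f ≈ˢ a ·ˢ (u ∘ˢ f)
  ·ˢ-∘ˢ a u f n =
    trans (sum-cong-≋ {suc n} (λ k → *-assoc a (u (toℕ k)) ((f ^ˢ toℕ k) n)))
          (sym (*-distribˡ-sum {suc n} a (λ k → u (toℕ k) * (f ^ˢ toℕ k) n)))

  1ˢ-∘ˢ : ∀ f → 1ˢ ∘ˢ f ≈ˢ 1ˢ
  1ˢ-∘ˢ f n = begin
    1# * 1ˢ n + sum {n} (λ k → 0# * (f ^ˢ suc (toℕ k)) n)
      ≈⟨ +-cong (*-identityˡ (1ˢ n)) (sum-cong-≋ {n} (λ k → zeroˡ ((f ^ˢ suc (toℕ k)) n))) ⟩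
    1ˢ n + sum {n} (λ _ → 0#)
      ≈⟨ +-congˡ (sum-replicate-zero n) ⟩
    1ˢ n + 0#
      ≈⟨ +-identityʳ _ ⟩
    1ˢ n ∎
    where open ≈-Reasoning

  ∘ˢ-identityˡ : ∀ f → f 0 ≈ 0# → xˢ ∘ˢ f ≈ˢ f
  ∘ˢ-identityˡ f f₀≈0 n = begin
    (xˢ ∘ˢ f) n                    ≈⟨ ∘ˢ-Horner f f₀≈0 xˢ n ⟩
    0# * 1ˢ n + (f *ˢ (1ˢ ∘ˢ f)) n ≈⟨ +-cong (zeroˡ _) (*ˢ-congˡ f (1ˢ-∘ˢ f) n) ⟩
    0# + (f *ˢ 1ˢ) n               ≈⟨ +-identityˡ _ ⟩
    (f *ˢ 1ˢ) n                    ≈⟨ *ˢ-identityʳ f n ⟩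
    f n                            ∎
    where open ≈-Reasoning

  -- This is u = u₀ + x u', from which uniqueness gives u(x) = u.
  id-Horner : Horner xˢ 1ˢ (λ u → u)
  id-Horner u zero    = begin
    u 0                                ≈⟨ *-identityʳ (u 0) ⟨
    u 0 * 1#                           ≈⟨ +-identityʳ _ ⟨
    u 0 * 1# + 0#                      ≈⟨ +-congˡ (trans (+-identityʳ _) (zeroˡ (u 1))) ⟨
    u 0 * 1# + (0# * u 1 + 0#)         ∎
    where open ≈-Reasoning
  id-Horner u (suc n) = begin
    u (suc n)                                           ≈⟨ *ˢ-identityˡ (tail u) n ⟨
    (1ˢ *ˢ tail u) n                                    ≈⟨ +-identityˡ _ ⟨
    0# + (1ˢ *ˢ tail u) n                               ≈⟨ +-congʳ (zeroˡ _) ⟨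
    0# * u (suc (suc n)) + (1ˢ *ˢ tail u) n             ≈⟨ +-identityˡ _ ⟨
    0# + (0# * u (suc (suc n)) + (1ˢ *ˢ tail u) n)      ≈⟨ +-congʳ (zeroʳ (u 0)) ⟨
    u 0 * 0# + (0# * u (suc (suc n)) + (1ˢ *ˢ tail u) n) ∎
    where open ≈-Reasoning

  ∘ˢ-identityʳ : ∀ u → u ∘ˢ xˢ ≈ˢ u
  ∘ˢ-identityʳ = Horner-unique xˢ (_∘ˢ xˢ) (λ u → u) refl (∘ˢ-Horner xˢ refl) id-Horner

  ∘ˢ-distribʳ-*ˢ : ∀ f → f 0 ≈ 0# → ∀ u v → (u *ˢ v) ∘ˢ f ≈ˢ (u ∘ˢ f) *ˢ (v ∘ˢ f)
  ∘ˢ-distribʳ-*ˢ f f₀≈0 u v =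
    Horner-unique f (λ u → (u *ˢ v) ∘ˢ f) (λ u → (u ∘ˢ f) *ˢ (v ∘ˢ f)) f₀≈0 left right u
    where
    open ≈ˢ-Reasoning
    -- The tail of `u *ˢ v` contributes `u 0 ·ˢ tail v`; together with the constant term `u 0 * v 0`
    -- it reassembles to `u 0 ·ˢ (v ∘ˢ f)` by Horner's rule for `v`, read backwards.
    left : Horner f (v ∘ˢ f) (λ u → (u *ˢ v) ∘ˢ f)
    left u = begin
      (u *ˢ v) ∘ˢ f
        ≈⟨ ∘ˢ-Horner f f₀≈0 (u *ˢ v) ⟩
      (u 0 * v 0 + 0#) ·ˢ 1ˢ +ˢ f *ˢ ((u 0 ·ˢ tail v +ˢ tail u *ˢ v) ∘ˢ f)
        ≈⟨ +ˢ-cong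
             (λ n → trans (*-congʳ (+-identityʳ _)) (*-assoc (u 0) (v 0) (1ˢ n)))
             (*ˢ-congˡ f (transˢ (∘ˢ-distribʳ-+ˢ f (u 0 ·ˢ tail v) (tail u *ˢ v))
                                 (+ˢ-cong (·ˢ-∘ˢ (u 0) (tail v) f) reflˢ))) ⟩
      u 0 ·ˢ v 0 ·ˢ 1ˢ +ˢ f *ˢ (u 0 ·ˢ (tail v ∘ˢ f) +ˢ (tail u *ˢ v) ∘ˢ f)
        ≈⟨ +ˢ-congˡ (u 0 ·ˢ v 0 ·ˢ 1ˢ) (transˢ
             (*ˢ-distribˡ-+ˢ f (u 0 ·ˢ (tail v ∘ˢ f)) ((tail u *ˢ v) ∘ˢ f))
             (+ˢ-cong (*ˢ-·ˢ f (u 0) (tail v ∘ˢ f)) reflˢ)) ⟩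
      u 0 ·ˢ v 0 ·ˢ 1ˢ +ˢ (u 0 ·ˢ (f *ˢ (tail v ∘ˢ f)) +ˢ f *ˢ ((tail u *ˢ v) ∘ˢ f))
        ≈⟨ (λ n → +-assoc _ _ _) ⟨
      u 0 ·ˢ v 0 ·ˢ 1ˢ +ˢ u 0 ·ˢ (f *ˢ (tail v ∘ˢ f)) +ˢ f *ˢ ((tail u *ˢ v) ∘ˢ f)
        ≈⟨ (λ n → +-congʳ (distribˡ (u 0) _ _)) ⟨
      u 0 ·ˢ (v 0 ·ˢ 1ˢ +ˢ f *ˢ (tail v ∘ˢ f)) +ˢ f *ˢ ((tail u *ˢ v) ∘ˢ f)
        ≈⟨ +ˢ-cong (·ˢ-cong refl (∘ˢ-Horner f f₀≈0 v)) reflˢ ⟨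
      u 0 ·ˢ (v ∘ˢ f) +ˢ f *ˢ ((tail u *ˢ v) ∘ˢ f) ∎

    right : Horner f (v ∘ˢ f) (λ u → (u ∘ˢ f) *ˢ (v ∘ˢ f))
    right u = begin
      (u ∘ˢ f) *ˢ (v ∘ˢ f)
        ≈⟨ *ˢ-congʳ (v ∘ˢ f) (∘ˢ-Horner f f₀≈0 u) ⟩
      (u 0 ·ˢ 1ˢ +ˢ f *ˢ (tail u ∘ˢ f)) *ˢ (v ∘ˢ f)
        ≈⟨ *ˢ-distribʳ-+ˢ (v ∘ˢ f) (u 0 ·ˢ 1ˢ) (f *ˢ (tail u ∘ˢ f)) ⟩
      (u 0 ·ˢ 1ˢ) *ˢ (v ∘ˢ f) +ˢ (f *ˢ (tail u ∘ˢ f)) *ˢ (v ∘ˢ f)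
        ≈⟨ +ˢ-cong (transˢ (·ˢ-*ˢ (u 0) 1ˢ (v ∘ˢ f)) (·ˢ-cong refl (*ˢ-identityˡ (v ∘ˢ f))))
                   (*ˢ-assoc f (tail u ∘ˢ f) (v ∘ˢ f)) ⟩
      u 0 ·ˢ (v ∘ˢ f) +ˢ f *ˢ ((tail u ∘ˢ f) *ˢ (v ∘ˢ f)) ∎

  ∘ˢ-assoc : ∀ f h → f 0 ≈ 0# → h 0 ≈ 0# → ∀ u → (u ∘ˢ f) ∘ˢ h ≈ˢ u ∘ˢ (f ∘ˢ h)
  ∘ˢ-assoc f h f₀≈0 h₀≈0 =
    Horner-unique (f ∘ˢ h) (λ u → (u ∘ˢ f) ∘ˢ h) (_∘ˢ (f ∘ˢ h)) f∘h₀≈0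
      left (∘ˢ-Horner (f ∘ˢ h) f∘h₀≈0)
    where
    open ≈ˢ-Reasoning
    f∘h₀≈0 : (f ∘ˢ h) 0 ≈ 0#
    f∘h₀≈0 = trans (∘ˢ-const f h) f₀≈0

    -- Substituting `h` into Horner's rule for `f` gives the rule for `f ∘ˢ h`, since substitution
    -- respects products.
    left : Horner (f ∘ˢ h) 1ˢ (λ u → (u ∘ˢ f) ∘ˢ h)
    left u = begin
      (u ∘ˢ f) ∘ˢ h
        ≈⟨ ∘ˢ-congʳ h (∘ˢ-Horner f f₀≈0 u) ⟩
      (u 0 ·ˢ 1ˢ +ˢ f *ˢ (tail u ∘ˢ f)) ∘ˢ h
        ≈⟨ ∘ˢ-distribʳ-+ˢ h (u 0 ·ˢ 1ˢ) (f *ˢ (tail u ∘ˢ f)) ⟩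
      (u 0 ·ˢ 1ˢ) ∘ˢ h +ˢ (f *ˢ (tail u ∘ˢ f)) ∘ˢ h
        ≈⟨ +ˢ-cong (transˢ (·ˢ-∘ˢ (u 0) 1ˢ h) (·ˢ-cong refl (1ˢ-∘ˢ h)))
                   (∘ˢ-distribʳ-*ˢ h h₀≈0 f (tail u ∘ˢ f)) ⟩
      u 0 ·ˢ 1ˢ +ˢ (f ∘ˢ h) *ˢ ((tail u ∘ˢ f) ∘ˢ h) ∎

  -- Reciprocals and compositional inverses

  module _ (step : ℕ → Series → Carrier) where

    truncation-≥ : ∀ {m} n → n ≤ m → truncation step n m ≡ 0#
    truncation-≥ zero    _   = ≡.refl
    truncation-≥ {m} (suc n) n<m with m ≡ᵇ n in eq
    ... | false = truncation-≥ n (ℕ.<⇒≤ n<m)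
    ... | true  = contradiction
      (≡.sym (ℕ.≡ᵇ⇒≡ m n (≡.subst T (≡.sym eq) tt))) (ℕ.<⇒≢ n<m)

    -- Coefficient `m` is set at stage `suc m`, and every later stage copies it.
    truncation-< : ∀ {m} n → m < n → truncation step n m ≡ recursiveSeries step m
    truncation-< {m} (suc n) m<1+n with m ≡ᵇ n in eq
    ... | true  = ≡.cong (recursiveSeries step)
      (≡.sym (ℕ.≡ᵇ⇒≡ m n (≡.subst T (≡.sym eq) tt)))
    ... | false = truncation-< n (ℕ.≤∧≢⇒< (s≤s⁻¹ m<1+n) λ m≡n →
      ≡.subst T eq (ℕ.≡⇒≡ᵇ m n m≡n))

  -- Isolates the unknown top term: `s` will come from the full series and `t` from its truncation.
  ∑-change-last : ∀ n {s t : Series} → (∀ {k} → k < n → s k ≈ t k) → t n ≈ 0# →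
    ∑[ k ≤ n ] s (toℕ k) ≈ ∑[ k ≤ n ] t (toℕ k) + s n
  ∑-change-last zero {s} {t} _ tₙ≈0 = begin
    s 0 + 0#         ≈⟨ +-comm (s 0) 0# ⟩
    0# + s 0         ≈⟨ +-congʳ (trans (+-identityʳ _) tₙ≈0) ⟨
    t 0 + 0# + s 0   ∎
    where open ≈-Reasoning
  ∑-change-last (suc n) s≈t tₙ≈0 =
    trans (+-cong (s≈t (s≤s z≤n)) (∑-change-last n (λ k<n → s≈t (s≤s k<n)) tₙ≈0))
          (sym (+-assoc _ _ _))

  -- A functional ∑_{k≤n} hₖ bₖ of a recursively defined h takes the prescribed
  -- value y as soon as the n-th step solves ∑_{k<n} hₖ bₖ + hₙ bₙ = y for hₙ.
  ∑-recursiveSeries : ∀ step n (b : Series) {a y} → a * b n ≈ 1# →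
    step n (truncation step n) ≈
      a * (y - ∑[ k ≤ n ] (truncation step n (toℕ k) * b (toℕ k))) →
    ∑[ k ≤ n ] (recursiveSeries step (toℕ k) * b (toℕ k)) ≈ y
  ∑-recursiveSeries step n b {a} {y} abₙ≈1 stepₙ = begin
    ∑[ k ≤ n ] (h (toℕ k) * b (toℕ k))
      ≈⟨ ∑-change-last n (λ {k} k<n → *-congʳ {b k} (reflexive (≡.sym (truncation-< step n k<n))))
           (x≈0⇒x*y≈0 (b n) (reflexive (truncation-≥ step n ℕ.≤-refl))) ⟩
    S + h n * b n            ≈⟨ +-congˡ (*-congʳ stepₙ) ⟩
    S + a * (y - S) * b n    ≈⟨ +-congˡ (*-congʳ (*-comm a (y - S))) ⟩
    S + (y - S) * a * b n    ≈⟨ +-congˡ (*-assoc (y - S) a (b n)) ⟩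
    S + (y - S) * (a * b n)  ≈⟨ +-congˡ (*-congˡ abₙ≈1) ⟩
    S + (y - S) * 1#         ≈⟨ +-congˡ (*-identityʳ (y - S)) ⟩
    S + (y - S)              ≈⟨ x+[y+z]≈y+[x+z] S y (- S) ⟩
    y + (S - S)              ≈⟨ +-congˡ (-‿inverseʳ S) ⟩
    y + 0#                   ≈⟨ +-identityʳ y ⟩
    y                        ∎
    where
    open ≈-Reasoning
    h : Series
    h = recursiveSeries step
    S : Carrier
    S = ∑[ k ≤ n ] (truncation step n (toℕ k) * b (toℕ k))

  inverseˡ : ∀ {x} (x#0 : x # 0#) → inverse x#0 * x ≈ 1#
  inverseˡ {x} x#0 =
    trans (*-congˡ (sym (x-0≈x x))) (proj₁ (proj₂ (#⇒invertible x#0)))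

  reciprocal-inverseˡ : ∀ g → F₀.series (reciprocal g) *ˢ F₀.series g ≈ˢ 1ˢ
  reciprocal-inverseˡ (mkF₀ g g₀#0) n =
    -- The weights `g (n ∸ k)` make the functional the `n`-th coefficient of a product with `g` on
    -- the right, and the top weight is `g 0`. The recursion has `g` on the left, hence the
    -- commutation.
    ∑-recursiveSeries step n (λ k → g (n ∸ k)) ag₀≈1
      (*-congˡ (+-congˡ (-‿cong (*ˢ-comm g (truncation step n) n))))
    where
    step : ℕ → Series → Carrier
    step n h = inverse g₀#0 * (1ˢ n - (g *ˢ h) n)

    ag₀≈1 : inverse g₀#0 * g (n ∸ n) ≈ 1#
    ag₀≈1 = trans (*-congˡ (reflexive (≡.cong g (ℕ.n∸n≡0 n)))) (inverseˡ g₀#0)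

  -- Each further factor `f` raises the order by at least one.
  ^ˢ-order : ∀ f → f 0 ≈ 0# → ∀ n {m} → m < n → (f ^ˢ n) m ≈ 0#
  ^ˢ-order f f₀≈0 (suc n) {m} (s≤s m≤n) =
    trans (*ˢ-cong-< f (f ^ˢ n) 0ˢ f₀≈0 m (λ j<m → ^ˢ-order f f₀≈0 n (ℕ.<-≤-trans j<m m≤n)))
          (*ˢ-zeroʳ f m)

  -- Supplies the top weight in the recursion for the compositional inverse, invertible because
  -- `f 1` is.
  ^ˢ-leading : ∀ f → f 0 ≈ 0# → ∀ n → (f ^ˢ n) n ≈ f 1 ^ n
  ^ˢ-leading f f₀≈0 zero = refl
  ^ˢ-leading f f₀≈0 (suc n) = begin
    f 0 * (f ^ˢ n) (suc n) + (tail f *ˢ (f ^ˢ n)) n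
      ≈⟨ trans (+-congʳ (x≈0⇒x*y≈0 _ f₀≈0)) (+-identityˡ _) ⟩
    (tail f *ˢ (f ^ˢ n)) n
      ≈⟨ leading-term n ⟩
    f 1 * (f ^ˢ n) n
      ≈⟨ *-congˡ (^ˢ-leading f f₀≈0 n) ⟩
    f 1 * f 1 ^ n ∎
    where
    open ≈-Reasoning
    leading-term : ∀ n → (tail f *ˢ (f ^ˢ n)) n ≈ f 1 * (f ^ˢ n) n
    leading-term zero    = +-identityʳ _
    -- All terms after the first involve coefficients of `f ^ˢ suc n` below its order.
    leading-term (suc n) = trans
      (+-congˡ (trans
        (*ˢ-cong-≤ (tail (tail f)) (f ^ˢ suc n) 0ˢ n (λ m≤n → ^ˢ-order f f₀≈0 (suc n) (s≤s m≤n)))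
        (*ˢ-zeroʳ (tail (tail f)) n)))
      (+-identityʳ _)

  1^n≈1 : ∀ n → 1# ^ n ≈ 1#
  1^n≈1 zero    = refl
  1^n≈1 (suc n) = trans (*-identityˡ _) (1^n≈1 n)

  compInverse-inverseˡ : ∀ f → F₁.series (compInverse f) ∘ˢ F₁.series f ≈ˢ xˢ
  compInverse-inverseˡ (mkF₁ f f₀≈0 f₁#0) n =
    -- With these weights the functional is `h ↦ (h ∘ˢ f) n`.
    ∑-recursiveSeries step n (λ k → (f ^ˢ k) n) af₁ⁿ≈1 refl
    where
    open ≈-Reasoning
    step : ℕ → Series → Carrier
    step n h = inverse f₁#0 ^ n * (xˢ n - (h ∘ˢ f) n)

    af₁ⁿ≈1 : inverse f₁#0 ^ n * (f ^ˢ n) n ≈ 1#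
    af₁ⁿ≈1 = begin
      inverse f₁#0 ^ n * (f ^ˢ n) n ≈⟨ *-congˡ (^ˢ-leading f f₀≈0 n) ⟩
      inverse f₁#0 ^ n * f 1 ^ n    ≈⟨ ^-distrib-* (inverse f₁#0) (f 1) n ⟨
      (inverse f₁#0 * f 1) ^ n      ≈⟨ ^-congˡ n (inverseˡ f₁#0) ⟩
      1# ^ n                        ≈⟨ 1^n≈1 n ⟩
      1#                            ∎

  -- The Riordan group

  monoid : Monoid _ _
  monoid = record
    { Carrier  = ℛ
    ; _≈_      = _≈ᴿ_
    ; _∙_      = _∙_
    ; ε        = ε
    ; isMonoid = record
      { isSemigroup = record
        { isMagma = record
          { isEquivalence = record
            { refl  = reflˢ , reflˢ
            ; sym   = λ (p , q) → symˢ p , symˢ q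
            ; trans = λ (p , q) (p′ , q′) → transˢ p p′ , transˢ q q′
            }
          ; ∙-cong = λ (g≈ , f≈) (u≈ , v≈) →
              *ˢ-cong g≈ (∘ˢ-cong u≈ f≈) , ∘ˢ-cong v≈ f≈
          }
        ; assoc = assoc
        }
      ; identity =
          (λ (mkF₀ u _ , mkF₁ v _ _) →
            transˢ (*ˢ-identityˡ (u ∘ˢ xˢ)) (∘ˢ-identityʳ u) , ∘ˢ-identityʳ v)
        , (λ (mkF₀ g _ , mkF₁ f f₀≈0 _) →
            transˢ (*ˢ-congˡ g (1ˢ-∘ˢ f)) (*ˢ-identityʳ g) , ∘ˢ-identityˡ f f₀≈0)
      }
    }
    where
    open ≈ˢ-Reasoning
    assoc : ∀ A B C → (A ∙ B) ∙ C ≈ᴿ A ∙ (B ∙ C)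
    assoc (mkF₀ g _ , mkF₁ f f₀≈0 _) (mkF₀ u _ , mkF₁ v v₀≈0 _) (mkF₀ w _ , mkF₁ z _ _) =
      (begin
        (g *ˢ (u ∘ˢ f)) *ˢ (w ∘ˢ (v ∘ˢ f))
          ≈⟨ *ˢ-congˡ (g *ˢ (u ∘ˢ f)) (∘ˢ-assoc v f v₀≈0 f₀≈0 w) ⟨
        (g *ˢ (u ∘ˢ f)) *ˢ ((w ∘ˢ v) ∘ˢ f)
          ≈⟨ *ˢ-assoc g (u ∘ˢ f) ((w ∘ˢ v) ∘ˢ f) ⟩
        g *ˢ ((u ∘ˢ f) *ˢ ((w ∘ˢ v) ∘ˢ f))
          ≈⟨ *ˢ-congˡ g (∘ˢ-distribʳ-*ˢ f f₀≈0 u (w ∘ˢ v)) ⟨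
        g *ˢ ((u *ˢ (w ∘ˢ v)) ∘ˢ f) ∎)
      , symˢ (∘ˢ-assoc v f v₀≈0 f₀≈0 z)

  -- Substitute `f` into `r *ˢ (g ∘ˢ f̄) ≈ˢ 1ˢ`: the second factor becomes `g ∘ˢ (f̄ ∘ˢ f)`, which
  -- is `g`.
  right-reciprocal : ∀ {g f f̄ r} → f 0 ≈ 0# → f̄ 0 ≈ 0# →
    f̄ ∘ˢ f ≈ˢ xˢ → r *ˢ (g ∘ˢ f̄) ≈ˢ 1ˢ → g *ˢ (r ∘ˢ f) ≈ˢ 1ˢ
  right-reciprocal {g} {f} {f̄} {r} f₀≈0 f̄₀≈0 f̄∘f≈x r*g∘f̄≈1 = begin
    g *ˢ (r ∘ˢ f)                ≈⟨ *ˢ-comm g (r ∘ˢ f) ⟩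
    (r ∘ˢ f) *ˢ g                ≈⟨ *ˢ-congˡ (r ∘ˢ f) (∘ˢ-identityʳ g) ⟨
    (r ∘ˢ f) *ˢ (g ∘ˢ xˢ)        ≈⟨ *ˢ-congˡ (r ∘ˢ f) (∘ˢ-congˡ g f̄∘f≈x) ⟨
    (r ∘ˢ f) *ˢ (g ∘ˢ (f̄ ∘ˢ f))  ≈⟨ *ˢ-congˡ (r ∘ˢ f) (∘ˢ-assoc f̄ f f̄₀≈0 f₀≈0 g) ⟨
    (r ∘ˢ f) *ˢ ((g ∘ˢ f̄) ∘ˢ f)  ≈⟨ ∘ˢ-distribʳ-*ˢ f f₀≈0 r (g ∘ˢ f̄) ⟨
    (r *ˢ (g ∘ˢ f̄)) ∘ˢ f         ≈⟨ ∘ˢ-congʳ f r*g∘f̄≈1 ⟩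
    1ˢ ∘ˢ f                      ≈⟨ 1ˢ-∘ˢ f ⟩
    1ˢ                           ∎
    where open ≈ˢ-Reasoning

  -- The second component of `A ∙ A ⁻¹` is f̄(f(x)), the very composite that the recursion for f̄
  -- makes equal to x.
  ∙-inverseʳ : ∀ A → A ∙ A ⁻¹ ≈ᴿ ε
  ∙-inverseʳ (g , f) =
      right-reciprocal {F₀.series g} {r = F₀.series (reciprocal (g ∘₀ compInverse f))}
        (F₁.const≈0 f) (F₁.const≈0 (compInverse f))
        (compInverse-inverseˡ f) (reciprocal-inverseˡ (g ∘₀ compInverse f))
    , compInverse-inverseˡ f

  group : Group _ _
  group = rightInverses⇒group monoid _⁻¹ ∙-inverseʳ

proposition7 : ∀ {c ℓ₁ ℓ₂} (K : HeytingField c ℓ₁ ℓ₂) → let open Riordan K in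
    CharacteristicZero →
    (P : ℛ) → IsPseudoInvolution P →
    (g : F₀) (f : F₁) →
    IsInvolution ((g , f) ⁻¹ ∙ P ∙ (g ∘₀ -X , f ∘₁ -X))
proposition7 K _ P P-pseudo g f =
  twisted-conjugate-involution group (g , f) (g ∘₀ -X , f ∘₁ -X) P (1₀ , -X)
    -- The product `(1₀ , -X) ∙ (g , f)` differs from `(g ∘₀ -X , f ∘₁ -X)` only by a factor `1ˢ` in
    -- its first component.
    (symˢ (*ˢ-identityˡ (F₀.series (g ∘₀ -X))) , reflˢ) P-pseudo
  where
  open Riordan K
  open RiordanGroup K
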